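{- The ideal $\mathrm{tr}(\mathscr N)$ is an HL ideal.
   Context: For $a\subseteq 2^{<\omega}$ let $\pi(a)=\{x\in2^\omega:\exists^\infty n\ (x\restriction n\in a)\}$. $\mathscr N$ is the ideal of Lebesgue null subsets of $2^\omega$ (with the standard product measure), and $\mathrm{tr}(\mathscr N)=\{a\subseteq2^{<\omega}:\pi(a)\in\mathscr N\}$, an ideal on the countable set $2^{<\omega}$. A tree is an initial subset of $(2^{<\omega},\subseteq)$ without maximal elements, perfect if every node has two incompatible extensions in it; $\mathbf S$ is the set of perfect trees; $p\restriction A=\{s\in p\cap2^n:n\in A\}$. An ideal $\mathcal I$ on a countable set (identified with $\omega$ via a bijection) is HL if for every $c:2^{<\omega}\to2$ there are $p\in\mathbf S$ and $A\in\mathcal I^+$ with $c$ constant on $p\restriction A$; equivalently $\mathcal I^+$ remains a reaping family after adding a Sacks real. -}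

module Defs where

open import Data.Bool using (Bool; true; false)
open import Data.Nat using (ℕ; zero; suc; _≤_)
open import Data.List using (List; []; _∷_; length)
open import Data.Product using (Σ; ∃; _×_; _,_)
open import Data.Rational using (ℚ; ½; 1ℚ; _*_; _+_; 0ℚ)
import Data.Rational as Q
open import Relation.Binary.PropositionalEquality using (_≡_)
open import Relation.Nullary using (¬_)
open import Function.Bundles using (_↔_; Inverse)

Str : Set
Str = List Bool

Real : Set
Real = ℕ → Bool

restrict : Real → ℕ → Str
restrict x zero    = []
restrict x (suc n) = x 0 ∷ restrict (λ i → x (suc i)) n

data _⊑_ : Str → Str → Set where
  []⊑ : ∀ {t} → [] ⊑ t
  ∷⊑  : ∀ {b s t} → s ⊑ t → (b ∷ s) ⊑ (b ∷ t)

π : (Str → Set) → Real → Set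
π a x = ∀ m → ∃ λ n → m ≤ n × a (restrict x n)

-- (1/2)^n, the measure of the basic clopen set [s] with |s| = n
half^ : ℕ → ℚ
half^ zero    = 1ℚ
half^ (suc n) = ½ * half^ n

sumUpTo : (ℕ → ℚ) → ℕ → ℚ
sumUpTo f zero    = 0ℚ
sumUpTo f (suc N) = sumUpTo f N + f N

-- Lebesgue null subsets of 2^ω (product measure): for every k there is a
-- sequence of basic clopen sets [σ i] covering X of total measure ≤ 2^{-k}.
Null : (Real → Set) → Set
Null X = ∀ (k : ℕ) → Σ (ℕ → Str) λ σ →
           (∀ x → X x → ∃ λ i → restrict x (length (σ i)) ≡ σ i)
         × (∀ N → sumUpTo (λ i → half^ (length (σ i))) N Q.≤ half^ k)

trN : (Str → Set) → Set
trN a = Null (π a)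

Incompatible : Str → Str → Set
Incompatible s t = ¬ (s ⊑ t) × ¬ (t ⊑ s)

record PerfectTree (p : Str → Set) : Set where
  field
    root    : p []
    initial : ∀ s t → s ⊑ t → p t → p s
    perfect : ∀ s → p s → ∃ λ t → ∃ λ u →
                s ⊑ t × s ⊑ u × p t × p u × Incompatible t u

HL : ((ℕ → Set) → Set) → Set₁
HL I = ∀ (c : Str → Bool) → Σ (Str → Set) λ p → Σ (ℕ → Set) λ A →
         PerfectTree p × ¬ I A ×
         (∃ λ (i : Bool) → ∀ s → p s → A (length s) → c s ≡ i)

trN-on-ω : ℕ ↔ Str → (ℕ → Set) → Set
trN-on-ω e B = trN (λ s → B (Inverse.from e s))

{-# OPTIONS --safe #-}
-- Label the levels N of the coloured tree by the strings e N.  For a finite tuple V of branches and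
-- a bound k, consider the union of the cylinders [e N] over the levels N at which all branches of V
-- have colour false and |e N| ≥ k.  Call m good if every m-tuple can be prolonged so that this union
-- has measure at least θ m = ½ + 2^-(m+1), for every k.
--
-- If every m is good, a fusion gives a perfect tree which is false on a set of levels whose cylinders
-- have measure ≥ ½ infinitely often, hence on a tr(N)-positive set.
--
-- Otherwise let x ∷ W be a bad tuple of least length m + 1.  Grow a perfect tree above x together with
-- a side tuple above W.  The side tuple can always be made false on measure θ m, while on all but
-- measure θ (m+1) of these levels the branch above x is forced to be true.  Before each splitting the
-- configuration is prolonged until the exceptional measure has nearly stopped growing; as both halves
-- of the split contain the old exceptional set, splitting then costs almost nothing, and the tree is
-- true on levels of measure ≥ θ m - θ (m+1) - small.
module Submission where

open import Defs
open import Data.Nat using (ℕ)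
open import Level using (0ℓ)
open import Axiom.ExcludedMiddle using (ExcludedMiddle)
open import Function.Bundles using (_↔_)

open import Data.Bool using (Bool; true; false; if_then_else_; not; _∧_; _∨_; T)
open import Data.Bool.Properties using (T-∧; T-∨; not-¬; ¬-not)
open import Data.Empty using (⊥-elim)
open import Data.List using (List; []; _∷_; length; map; _++_)
import Data.List.Membership.Propositional as List
open import Data.List.Membership.Propositional.Properties using (∈-++⁺ˡ; ∈-++⁺ʳ; ∈-++⁻; ∈-map⁺; ∈-map⁻)
open import Data.List.Properties using (∷-injective)
open import Data.List.Relation.Binary.Pointwise as Pointwise using (Pointwise; []; _∷_)
open import Data.List.Relation.Unary.All as All using (All; []; _∷_)
import Data.List.Relation.Unary.All.Properties as All
open import Data.List.Relation.Unary.Any using (here; there)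
open import Data.Nat as ℕ using (zero; suc)
import Data.Nat.Properties as ℕₚ
open import Data.Product using (Σ; ∃; _×_; _,_; proj₁; proj₂)
open import Data.Rational using (ℚ; 0ℚ; 1ℚ; ½; _+_; _*_; -_; _≤_; _<_)
open import Data.Rational.Properties as ℚₚ using (module ≤-Reasoning)
open import Data.Rational.Solver using (module +-*-Solver)
open import Data.Sum using (_⊎_; inj₁; inj₂; [_,_]′)
open import Data.Unit using (tt)
open import Function.Base using (_∘_; id)
open import Function.Bundles using (Equivalence; Inverse)
open import Relation.Binary.PropositionalEquality using (_≡_; _≢_; refl; sym; trans; cong; cong₂; subst; subst₂)
open import Relation.Nullary using (¬_; yes; no; contradiction)
open import Relation.Nullary.Decidable using (decidable-stable)

open +-*-Solver using (solve; _:+_; _:*_; :-_; _:=_; con)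

-- Rational inequalities and powers of one half

+-cancelʳ-≤ : ∀ r {p q} → p + r ≤ q + r → p ≤ q
+-cancelʳ-≤ r {p} {q} h = subst₂ _≤_ (undo p r) (undo q r) (ℚₚ.+-monoˡ-≤ (- r) h)
  where
  undo : ∀ p r → p + r + - r ≡ p
  undo = solve 2 (λ p r → p :+ r :+ :- r := p) refl

half-double : ∀ n → half^ (suc n) + half^ (suc n) ≡ half^ n
half-double n = solve 1 (λ h → con ½ :* h :+ con ½ :* h := h) refl (half^ n)

half-pos : ∀ n → 0ℚ < half^ n
half-pos zero    = ℚₚ.positive⁻¹ 1ℚ
half-pos (suc n) = ℚₚ.*-monoʳ-<-pos ½ (half-pos n)

half-mono : ∀ {p q} → p ≤ q → ½ * p ≤ ½ * q
half-mono = ℚₚ.*-monoˡ-≤-nonNeg ½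

-- Clopen subsets of Cantor space

tail : Real → Real
tail x i = x (suc i)

cons : Bool → Real → Real
cons b x zero    = b
cons b x (suc i) = x i

-- Finite decision trees: membership reads finitely many bits, and the measure is a rational found
-- by recursion. Different trees may denote the same set, so inclusion is taken pointwise below.
data Clopen : Set where
  leaf : Bool → Clopen
  node : Clopen → Clopen → Clopen

child : Bool → Clopen → Clopen
child b     (leaf v)   = leaf v
child false (node l r) = l
child true  (node l r) = r

mem : Clopen → Real → Bool
mem (leaf v)   x = v
mem (node l r) x = if x 0 then mem r (tail x) else mem l (tail x)

infix 4 _∈_ _⊆_

_∈_ : Real → Clopen → Set
x ∈ a = T (mem a x)

_⊆_ : Clopen → Clopen → Set
a ⊆ b = ∀ x → x ∈ a → x ∈ b

infixr 6 _∪_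
infixr 7 _∩_

_∪_ : Clopen → Clopen → Clopen
leaf true  ∪ b = leaf true
leaf false ∪ b = b
node l r   ∪ b = node (l ∪ child false b) (r ∪ child true b)

_∩_ : Clopen → Clopen → Clopen
leaf true  ∩ b = b
leaf false ∩ b = leaf false
node l r   ∩ b = node (l ∩ child false b) (r ∩ child true b)

∁ : Clopen → Clopen
∁ (leaf v)   = leaf (not v)
∁ (node l r) = node (∁ l) (∁ r)

μ : Clopen → ℚ
μ (leaf true)  = 1ℚ
μ (leaf false) = 0ℚ
μ (node l r)   = ½ * (μ l + μ r)

mem-child : ∀ a x → mem a x ≡ mem (child (x 0) a) (tail x)
mem-child (leaf v)   x = refl
mem-child (node l r) x with x 0
... | true  = refl
... | false = refl

mem-∪ : ∀ a b x → mem (a ∪ b) x ≡ mem a x ∨ mem b x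
mem-∪ (leaf true)  b x = refl
mem-∪ (leaf false) b x = refl
mem-∪ (node l r)   b x rewrite mem-child b x with x 0
... | true  = mem-∪ r (child true b) (tail x)
... | false = mem-∪ l (child false b) (tail x)

mem-∩ : ∀ a b x → mem (a ∩ b) x ≡ mem a x ∧ mem b x
mem-∩ (leaf true)  b x = refl
mem-∩ (leaf false) b x = refl
mem-∩ (node l r)   b x rewrite mem-child b x with x 0
... | true  = mem-∩ r (child true b) (tail x)
... | false = mem-∩ l (child false b) (tail x)

mem-∁ : ∀ a x → mem (∁ a) x ≡ not (mem a x)
mem-∁ (leaf v)   x = refl
mem-∁ (node l r) x with x 0
... | true  = mem-∁ r (tail x)
... | false = mem-∁ l (tail x)

∈-∪⁻ : ∀ {a b x} → x ∈ a ∪ b → x ∈ a ⊎ x ∈ b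
∈-∪⁻ {a} {b} {x} h = Equivalence.to T-∨ (subst T (mem-∪ a b x) h)

∈-∪⁺ : ∀ {a b x} → x ∈ a ⊎ x ∈ b → x ∈ a ∪ b
∈-∪⁺ {a} {b} {x} h = subst T (sym (mem-∪ a b x)) (Equivalence.from T-∨ h)

∈-∩⁻ : ∀ {a b x} → x ∈ a ∩ b → x ∈ a × x ∈ b
∈-∩⁻ {a} {b} {x} h = Equivalence.to T-∧ (subst T (mem-∩ a b x) h)

∈-∩⁺ : ∀ {a b x} → x ∈ a → x ∈ b → x ∈ a ∩ b
∈-∩⁺ {a} {b} {x} h k = subst T (sym (mem-∩ a b x)) (Equivalence.from T-∧ (h , k))

∈-∁⁻ : ∀ {a x} → x ∈ ∁ a → ¬ x ∈ a
∈-∁⁻ {a} {x} h k with mem a x | mem-∁ a x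
... | true | eq = subst T eq h

∈-em : ∀ a x → x ∈ a ⊎ x ∈ ∁ a
∈-em a x with mem a x | mem-∁ a x
... | true  | eq = inj₁ tt
... | false | eq = inj₂ (subst T (sym eq) tt)

μ-nonneg : ∀ a → 0ℚ ≤ μ a
μ-nonneg (leaf true)  = ℚₚ.nonNegative⁻¹ 1ℚ
μ-nonneg (leaf false) = ℚₚ.≤-refl
μ-nonneg (node l r)   = half-mono (ℚₚ.+-mono-≤ (μ-nonneg l) (μ-nonneg r))

μ-child : ∀ a → μ a ≡ ½ * (μ (child false a) + μ (child true a))
μ-child (leaf true)  = refl
μ-child (leaf false) = refl
μ-child (node l r)   = refl

child-⊆ : ∀ {a b} v → a ⊆ b → child v a ⊆ child v b
child-⊆ {a} {b} v h x p =
  subst T (mem-child b (cons v x)) (h (cons v x) (subst T (sym (mem-child a (cons v x))) p))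

μ-mono : ∀ a b → a ⊆ b → μ a ≤ μ b
μ-mono (leaf false) b h = μ-nonneg b
μ-mono (leaf true) (leaf true)  h = ℚₚ.≤-refl
μ-mono (leaf true) (leaf false) h = ⊥-elim (h (λ _ → true) tt)
μ-mono (leaf true) b@(node l r) h =
  half-mono (ℚₚ.+-mono-≤ (μ-mono (leaf true) l (child-⊆ {leaf true} {b} false h))
                         (μ-mono (leaf true) r (child-⊆ {leaf true} {b} true h)))
μ-mono a@(node l r) b h rewrite μ-child b =
  half-mono (ℚₚ.+-mono-≤ (μ-mono l (child false b) (child-⊆ {a} {b} false h))
                         (μ-mono r (child true b) (child-⊆ {a} {b} true h)))

μ≤1 : ∀ a → μ a ≤ 1ℚ
μ≤1 a = μ-mono a (leaf true) (λ _ _ → tt)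

μ-modular : ∀ a b → μ (a ∪ b) + μ (a ∩ b) ≡ μ a + μ b
μ-modular (leaf true)  b = refl
μ-modular (leaf false) b = ℚₚ.+-comm (μ b) 0ℚ
μ-modular (node l r)   b rewrite μ-child b =
  trans (collect (μ (l ∪ b₀)) (μ (r ∪ b₁)) (μ (l ∩ b₀)) (μ (r ∩ b₁)))
    (trans (cong₂ (λ p q → ½ * (p + q)) (μ-modular l b₀) (μ-modular r b₁))
           (sym (collect (μ l) (μ r) (μ b₀) (μ b₁))))
  where
  b₀ = child false b
  b₁ = child true b
  collect : ∀ p q p′ q′ → ½ * (p + q) + ½ * (p′ + q′) ≡ ½ * ((p + p′) + (q + q′))
  collect = solve 4 (λ p q p′ q′ → con ½ :* (p :+ q) :+ con ½ :* (p′ :+ q′)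
                                    := con ½ :* ((p :+ p′) :+ (q :+ q′))) refl

μ-∪-≤ : ∀ a b → μ (a ∪ b) ≤ μ a + μ b
μ-∪-≤ a b = begin
  μ (a ∪ b)             ≡⟨ ℚₚ.+-identityʳ (μ (a ∪ b)) ⟨
  μ (a ∪ b) + 0ℚ        ≤⟨ ℚₚ.+-monoʳ-≤ (μ (a ∪ b)) (μ-nonneg (a ∩ b)) ⟩
  μ (a ∪ b) + μ (a ∩ b) ≡⟨ μ-modular a b ⟩
  μ a + μ b             ∎
  where open ≤-Reasoning

-- By modularity the common part `c`, which lies in `a ∩ b`, is counted only once, so only the two
-- increments over `c` add up. This makes splitting cheap later.
μ-∪-increment : ∀ {a b c δ} → c ⊆ a → c ⊆ b → μ a ≤ μ c + δ → μ b ≤ μ c + δ →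
                μ (a ∪ b) ≤ μ c + (δ + δ)
μ-∪-increment {a} {b} {c} {δ} ca cb ha hb = +-cancelʳ-≤ (μ c) (begin
  μ (a ∪ b) + μ c       ≤⟨ ℚₚ.+-monoʳ-≤ (μ (a ∪ b))
                             (μ-mono c (a ∩ b) (λ x p → ∈-∩⁺ {a} {b} (ca x p) (cb x p))) ⟩
  μ (a ∪ b) + μ (a ∩ b) ≡⟨ μ-modular a b ⟩
  μ a + μ b             ≤⟨ ℚₚ.+-mono-≤ ha hb ⟩
  (μ c + δ) + (μ c + δ) ≡⟨ solve 2 (λ c d → (c :+ d) :+ (c :+ d) := c :+ (d :+ d) :+ c) refl (μ c) δ ⟩
  μ c + (δ + δ) + μ c   ∎)
  where open ≤-Reasoning

-- The part of `a` outside `b` lies in `d` outside `b`, which has measure at most `δ`.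
μ-∩-decrement : ∀ {a b d δ} → a ∪ b ⊆ d → μ d ≤ μ b + δ → μ a ≤ μ (a ∩ b) + δ
μ-∩-decrement {a} {b} {d} {δ} sub hd = +-cancelʳ-≤ (μ b) (begin
  μ a + μ b               ≡⟨ μ-modular a b ⟨
  μ (a ∪ b) + μ (a ∩ b)   ≤⟨ ℚₚ.+-monoˡ-≤ (μ (a ∩ b)) (ℚₚ.≤-trans (μ-mono (a ∪ b) d sub) hd) ⟩
  (μ b + δ) + μ (a ∩ b)   ≡⟨ solve 3 (λ b d i → (b :+ d) :+ i := i :+ d :+ b) refl (μ b) δ (μ (a ∩ b)) ⟩
  μ (a ∩ b) + δ + μ b     ∎)
  where open ≤-Reasoning

-- Cylinders, finite unions and finite intersections

cyl : Str → Clopen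
cyl []          = leaf true
cyl (false ∷ s) = node (cyl s) (leaf false)
cyl (true  ∷ s) = node (leaf false) (cyl s)

∈-cyl⁻ : ∀ s {x} → x ∈ cyl s → restrict x (length s) ≡ s
∈-cyl⁻ [] h = refl
∈-cyl⁻ (false ∷ s) {x} h with x 0
... | false = cong (false ∷_) (∈-cyl⁻ s h)
∈-cyl⁻ (true ∷ s) {x} h with x 0
... | true = cong (true ∷_) (∈-cyl⁻ s h)

∈-cyl⁺ : ∀ s {x} → restrict x (length s) ≡ s → x ∈ cyl s
∈-cyl⁺ [] h = tt
∈-cyl⁺ (false ∷ s) {x} h rewrite proj₁ (∷-injective h) = ∈-cyl⁺ s (proj₂ (∷-injective h))
∈-cyl⁺ (true  ∷ s) {x} h rewrite proj₁ (∷-injective h) = ∈-cyl⁺ s (proj₂ (∷-injective h))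

μ-cyl : ∀ s → μ (cyl s) ≡ half^ (length s)
μ-cyl []          = refl
μ-cyl (false ∷ s) rewrite μ-cyl s = cong (½ *_) (ℚₚ.+-identityʳ (half^ (length s)))
μ-cyl (true  ∷ s) rewrite μ-cyl s = cong (½ *_) (ℚₚ.+-identityˡ (half^ (length s)))

⋃ : (ℕ → Clopen) → ℕ → Clopen
⋃ Z zero    = leaf false
⋃ Z (suc n) = ⋃ Z n ∪ Z n

∈-⋃⁺ : ∀ Z {n i x} → i ℕ.< n → x ∈ Z i → x ∈ ⋃ Z n
∈-⋃⁺ Z {suc n} {i} i<n h with ℕₚ.m<1+n⇒m<n∨m≡n i<n
... | inj₁ i<n′ = ∈-∪⁺ {⋃ Z n} {Z n} (inj₁ (∈-⋃⁺ Z i<n′ h))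
... | inj₂ refl = ∈-∪⁺ {⋃ Z n} {Z n} (inj₂ h)

∈-⋃⁻ : ∀ Z n {x} → x ∈ ⋃ Z n → ∃ λ i → i ℕ.< n × x ∈ Z i
∈-⋃⁻ Z (suc n) h with ∈-∪⁻ {⋃ Z n} {Z n} h
... | inj₂ p = n , ℕₚ.≤-refl , p
... | inj₁ p with ∈-⋃⁻ Z n p
...   | i , i<n , q = i , ℕₚ.m<n⇒m<1+n i<n , q

μ-⋃-cyl : ∀ σ N → μ (⋃ (cyl ∘ σ) N) ≤ sumUpTo (λ i → half^ (length (σ i))) N
μ-⋃-cyl σ zero    = ℚₚ.≤-refl
μ-⋃-cyl σ (suc N) = ℚₚ.≤-trans (μ-∪-≤ (⋃ (cyl ∘ σ) N) (cyl (σ N)))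
  (ℚₚ.+-mono-≤ (μ-⋃-cyl σ N) (ℚₚ.≤-reflexive (μ-cyl (σ N))))

⋂ : (ℕ → Clopen) → ℕ → Clopen
⋂ Z zero    = leaf true
⋂ Z (suc n) = ⋂ Z n ∩ Z n

∈-⋂⁻ : ∀ Z {n i x} → x ∈ ⋂ Z n → i ℕ.< n → x ∈ Z i
∈-⋂⁻ Z {suc n} {i} h i<n with ∈-∩⁻ {⋂ Z n} {Z n} h | ℕₚ.m<1+n⇒m<n∨m≡n i<n
... | p , q | inj₁ i<n′ = ∈-⋂⁻ Z p i<n′
... | p , q | inj₂ refl = q

-- Classical reasoning and compactness of Cantor space

module Classical (em : ExcludedMiddle 0ℓ) where

  by-contradiction : {P : Set} → ¬ ¬ P → P
  by-contradiction = decidable-stable em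

  ¬∀⇒∃¬ : {A : Set} {P : A → Set} → ¬ (∀ x → P x) → ∃ λ x → ¬ P x
  ¬∀⇒∃¬ h = by-contradiction λ k → h λ x → by-contradiction λ ¬p → k (x , ¬p)

  μ-pos⇒inhabited : ∀ a → 0ℚ < μ a → ∃ λ x → x ∈ a
  μ-pos⇒inhabited a h = by-contradiction λ k →
    ℚₚ.<-irrefl refl (ℚₚ.<-≤-trans h (μ-mono a (leaf false) (λ x p → k (x , p))))

  -- Bisection: if values above x exceed f x by at most d, then either some y ≽ x has gained
  -- ½ d already, or x itself cannot gain more than ½ d.
  stabilise : {X : Set} (_≼_ : X → X → Set) → (∀ {x} → x ≼ x) →
              (∀ {x y z} → x ≼ y → y ≼ z → x ≼ z) →
              (f : X → Clopen) → ∀ k x →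
              ∃ λ y → x ≼ y × (∀ z → y ≼ z → μ (f z) ≤ μ (f y) + half^ k)
  stabilise _≼_ rfl trn f zero x = x , rfl , λ z _ → begin
    μ (f z)        ≤⟨ μ≤1 (f z) ⟩
    1ℚ             ≡⟨ ℚₚ.+-identityˡ 1ℚ ⟨
    0ℚ + 1ℚ        ≤⟨ ℚₚ.+-monoˡ-≤ 1ℚ (μ-nonneg (f x)) ⟩
    μ (f x) + 1ℚ   ∎
    where open ≤-Reasoning
  stabilise _≼_ rfl trn f (suc k) x with stabilise _≼_ rfl trn f k x
  ... | y , x≼y , bound with em {∃ λ z → y ≼ z × μ (f y) + half^ (suc k) ≤ μ (f z)}
  ...   | no none = y , x≼y , λ z y≼z →
            by-contradiction λ h → none (z , y≼z , ℚₚ.<⇒≤ (ℚₚ.≰⇒> h))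
  ...   | yes (z , y≼z , gain) = z , trn x≼y y≼z , λ w z≼w → begin
            μ (f w)                                     ≤⟨ bound w (trn y≼z z≼w) ⟩
            μ (f y) + half^ k                           ≡⟨ cong (μ (f y) +_) (half-double k) ⟨
            μ (f y) + (half^ (suc k) + half^ (suc k))   ≡⟨ ℚₚ.+-assoc (μ (f y)) (half^ (suc k)) (half^ (suc k)) ⟨
            μ (f y) + half^ (suc k) + half^ (suc k)     ≤⟨ ℚₚ.+-monoˡ-≤ (half^ (suc k)) gain ⟩
            μ (f z) + half^ (suc k)                     ∎
    where open ≤-Reasoning

  -- The finite intersection property, required of initial segments of the sequence only.
  Satisfiable : (ℕ → Clopen) → Set
  Satisfiable Z = ∀ n → ∃ λ x → ∀ i → i ℕ.< n → x ∈ Z i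

  -- The step of König's lemma. If the first `m` constraints exclude the bit false, then a point
  -- meeting the first `m ⊔ n` of them starts with true, and its tail meets the first `n` shifted
  -- constraints.
  satisfiable-child : ∀ Z → Satisfiable Z → ∃ λ b → Satisfiable (child b ∘ Z)
  satisfiable-child Z sat with em {Satisfiable (child false ∘ Z)}
  ... | yes h = false , h
  ... | no ¬h with ¬∀⇒∃¬ ¬h
  ...   | m , unsat = true , go
    where
    go : Satisfiable (child true ∘ Z)
    go n with sat (m ℕ.⊔ n)
    ... | x , h with x 0 in eq
    ...   | true = tail x , λ i i<n → subst (λ b → tail x ∈ child b (Z i)) eq
              (subst T (mem-child (Z i) x) (h i (ℕₚ.<-≤-trans i<n (ℕₚ.m≤n⊔m m n))))
    ...   | false = ⊥-elim (unsat (tail x , λ i i<m → subst (λ b → tail x ∈ child b (Z i)) eq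
              (subst T (mem-child (Z i) x) (h i (ℕₚ.<-≤-trans i<m (ℕₚ.m≤m⊔n m n))))))

  branch : ∀ Z → Satisfiable Z → Real
  branch Z sat zero    = proj₁ (satisfiable-child Z sat)
  branch Z sat (suc n) = branch (child (proj₁ (satisfiable-child Z sat)) ∘ Z) (proj₂ (satisfiable-child Z sat)) n

  -- Induction on the decision tree of the single constraint `Z i`. It is named separately as `a`
  -- because the whole sequence changes at each step. At a leaf any point supplied by `sat` decides
  -- membership.
  branch-∈ : ∀ a Z (sat : Satisfiable Z) i → Z i ≡ a → branch Z sat ∈ a
  branch-∈ (leaf v) Z sat i eq with sat (suc i)
  ... | x , h = subst (x ∈_) eq (h i ℕₚ.≤-refl)
  branch-∈ (node l r) Z sat i eq with satisfiable-child Z sat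
  ... | true  , sat′ = branch-∈ r (child true ∘ Z) sat′ i (cong (child true) eq)
  ... | false , sat′ = branch-∈ l (child false ∘ Z) sat′ i (cong (child false) eq)

  compactness : ∀ Z → Satisfiable Z → ∃ λ x → ∀ i → x ∈ Z i
  compactness Z sat = branch Z sat , λ i → branch-∈ (Z i) Z sat i refl

  -- The limsup of clopen sets with measures bounded below

  module _ (q : ℕ) (W : ℕ → Clopen) (big : ∀ t → half^ q ≤ μ (W t)) where

    private
      shrink : ∀ {h hⱼ δ p r} → δ + δ ≡ hⱼ → h + hⱼ ≤ p → p ≤ r + δ → h + δ ≤ r
      shrink {h} {_} {δ} {p} {r} refl h≤p p≤r = +-cancelʳ-≤ δ (begin
        h + δ + δ   ≡⟨ ℚₚ.+-assoc h δ δ ⟩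
        h + (δ + δ) ≤⟨ h≤p ⟩
        p           ≤⟨ p≤r ⟩
        r + δ       ∎)
        where open ≤-Reasoning

      remainder : ∀ {h g p r o} → h + g ≤ p → p ≤ r + o → o ≤ h → g ≤ r
      remainder {h} {g} {p} {r} {o} lower upper o≤h = +-cancelʳ-≤ h (begin
        g + h ≡⟨ ℚₚ.+-comm g h ⟩
        h + g ≤⟨ lower ⟩
        p     ≤⟨ upper ⟩
        r + o ≤⟨ ℚₚ.+-monoʳ-≤ r o≤h ⟩
        r + h ∎)
        where open ≤-Reasoning

      from-stage : ℕ → ℕ → Clopen
      from-stage i = ⋃ (λ j → W (i ℕ.+ j))

      cutoff : ∀ i → ∃ λ n → 0 ℕ.≤ n ×
               (∀ n′ → n ℕ.≤ n′ → μ (from-stage i n′) ≤ μ (from-stage i n) + half^ (suc (i ℕ.+ suc q)))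
      cutoff i = stabilise ℕ._≤_ ℕₚ.≤-refl ℕₚ.≤-trans (from-stage i) (suc (i ℕ.+ suc q)) 0

      -- A finite part of ⋃ { W t ∣ t ≥ i } which exhausts it up to half^ (i + q + 2).
      U : ℕ → Clopen
      U i = from-stage i (proj₁ (cutoff i))

      -- Induction on `j`: for `t ≥ j` the set `W t` is part of the tail union from `j`, which `U j`
      -- exhausts up to `δ`. Intersecting with `U j` thus costs at most half of the slack
      -- `half^ (j + q + 1)`.
      U-large : ∀ j t → j ℕ.≤ t → half^ (suc q) + half^ (j ℕ.+ suc q) ≤ μ (W t ∩ ⋂ U j)
      U-large zero t _ = begin
        half^ (suc q) + half^ (suc q) ≡⟨ half-double q ⟩
        half^ q                       ≤⟨ big t ⟩
        μ (W t)                       ≤⟨ μ-mono (W t) (W t ∩ leaf true)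
                                           (λ x h → ∈-∩⁺ {W t} {leaf true} h tt) ⟩
        μ (W t ∩ leaf true)           ∎
        where open ≤-Reasoning
      U-large (suc j) t j<t = shrink {half^ (suc q)} {half^ (j ℕ.+ suc q)} {δ} {μ (W t ∩ ⋂ U j)} {μ (W t ∩ ⋂ U (suc j))}
        (half-double (j ℕ.+ suc q)) (U-large j t (ℕₚ.<⇒≤ j<t)) (ℚₚ.≤-trans
        (μ-∩-decrement {W t ∩ ⋂ U j} {U j} {D} {δ} D-covers
          (proj₂ (proj₂ (cutoff j)) n (ℕₚ.m≤m⊔n (proj₁ (cutoff j)) (suc (t ℕ.∸ j)))))
        (ℚₚ.+-monoˡ-≤ δ (μ-mono ((W t ∩ ⋂ U j) ∩ U j) (W t ∩ ⋂ U (suc j)) reassociate)))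
        where
        δ = half^ (suc (j ℕ.+ suc q))
        -- At least the cutoff, and large enough for the union to include `W t`, which has offset
        -- `t ∸ j` from stage `j`.
        n = proj₁ (cutoff j) ℕ.⊔ suc (t ℕ.∸ j)
        D = from-stage j n
        W-shift : ∀ {x} → x ∈ W t → x ∈ W (j ℕ.+ (t ℕ.∸ j))
        W-shift {x} = subst (λ s → x ∈ W s) (sym (ℕₚ.m+[n∸m]≡n (ℕₚ.<⇒≤ j<t)))
        D-covers : (W t ∩ ⋂ U j) ∪ U j ⊆ D
        D-covers x h with ∈-∪⁻ {W t ∩ ⋂ U j} {U j} h
        ... | inj₁ p = ∈-⋃⁺ (λ i → W (j ℕ.+ i)) (ℕₚ.m≤n⊔m (proj₁ (cutoff j)) (suc (t ℕ.∸ j)))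
                         (W-shift (proj₁ (∈-∩⁻ {W t} {⋂ U j} p)))
        ... | inj₂ p with ∈-⋃⁻ (λ i → W (j ℕ.+ i)) (proj₁ (cutoff j)) p
        ...   | i , i<n , r = ∈-⋃⁺ (λ i → W (j ℕ.+ i))
                                (ℕₚ.<-≤-trans i<n (ℕₚ.m≤m⊔n (proj₁ (cutoff j)) (suc (t ℕ.∸ j)))) r
        reassociate : (W t ∩ ⋂ U j) ∩ U j ⊆ W t ∩ ⋂ U (suc j)
        reassociate x h with ∈-∩⁻ {W t ∩ ⋂ U j} {U j} h
        ... | p , r with ∈-∩⁻ {W t} {⋂ U j} p
        ...   | p₁ , p₂ = ∈-∩⁺ {W t} {⋂ U (suc j)} p₁ (∈-∩⁺ {⋂ U j} {U j} p₂ r)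

      -- The first `n` cylinders remove at most `half^ (q + 1)` from a part of `⋂ U n` whose measure
      -- exceeds this by `half^ (n + q + 1)`, so a point remains.
      avoid-cover : (σ : ℕ → Str) → (∀ N → sumUpTo (λ i → half^ (length (σ i))) N ≤ half^ (suc q)) →
                    Satisfiable (λ i → U i ∩ ∁ (cyl (σ i)))
      avoid-cover σ small n = x , λ i i<n →
        ∈-∩⁺ {U i} {∁ (cyl (σ i))} (∈-⋂⁻ U (proj₁ x∈) i<n)
          ([ (λ p → ⊥-elim (∈-∁⁻ {O} (proj₂ x∈) (∈-⋃⁺ (cyl ∘ σ) i<n p))) , id ]′ (∈-em (cyl (σ i)) x))
        where
        O = ⋃ (cyl ∘ σ) n
        split : W n ∩ ⋂ U n ⊆ (⋂ U n ∩ ∁ O) ∪ O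
        split x h with ∈-em O x
        ... | inj₁ p = ∈-∪⁺ {⋂ U n ∩ ∁ O} {O} (inj₂ p)
        ... | inj₂ p = ∈-∪⁺ {⋂ U n ∩ ∁ O} {O}
                         (inj₁ (∈-∩⁺ {⋂ U n} {∁ O} (proj₂ (∈-∩⁻ {W n} {⋂ U n} h)) p))
        rest-large : half^ (n ℕ.+ suc q) ≤ μ (⋂ U n ∩ ∁ O)
        rest-large = remainder {half^ (suc q)} {half^ (n ℕ.+ suc q)} {μ (W n ∩ ⋂ U n)} {μ (⋂ U n ∩ ∁ O)} {μ O}
          (U-large n n ℕₚ.≤-refl)
          (ℚₚ.≤-trans (μ-mono (W n ∩ ⋂ U n) ((⋂ U n ∩ ∁ O) ∪ O) split) (μ-∪-≤ (⋂ U n ∩ ∁ O) O))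
          (ℚₚ.≤-trans (μ-⋃-cyl σ n) (small n))
        rest-inhabited : ∃ λ x → x ∈ ⋂ U n ∩ ∁ O
        rest-inhabited = μ-pos⇒inhabited (⋂ U n ∩ ∁ O) (ℚₚ.<-≤-trans (half-pos (n ℕ.+ suc q)) rest-large)
        x = proj₁ rest-inhabited
        x∈ = ∈-∩⁻ {⋂ U n} {∁ O} (proj₂ rest-inhabited)

      U-∩⇒limsup : ∀ x → (∀ i → x ∈ U i) → ∀ n → ∃ λ t → n ℕ.≤ t × x ∈ W t
      U-∩⇒limsup x x∈U n =
        let j , _ , p = ∈-⋃⁻ (λ j → W (n ℕ.+ j)) (proj₁ (cutoff n)) {x} (x∈U n)
        in n ℕ.+ j , ℕₚ.m≤m+n n j , p

      escape : (σ : ℕ → Str) → Satisfiable (λ i → U i ∩ ∁ (cyl (σ i))) →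
               ∃ λ x → (∀ i → x ∈ U i) × (∀ i → ¬ x ∈ cyl (σ i))
      escape σ sat =
        let x , x∈Z = compactness (λ i → U i ∩ ∁ (cyl (σ i))) sat
        in x , (λ i → proj₁ (∈-∩⁻ {U i} {∁ (cyl (σ i))} {x} (x∈Z i)))
             , (λ i → ∈-∁⁻ {cyl (σ i)} {x} (proj₂ (∈-∩⁻ {U i} {∁ (cyl (σ i))} {x} (x∈Z i))))

    -- Take a cover of measure at most half of the lower bound `half^ q`. By compactness some point
    -- lies in every `U i` and outside the whole cover. As `U i` only unites sets `W t` with
    -- `t ≥ i`, the point is in the limsup.
    limsup-not-null : (X : Real → Set) → (∀ x → (∀ n → ∃ λ t → n ℕ.≤ t × x ∈ W t) → X x) → ¬ Null X
    limsup-not-null X limsup⊆X null =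
      let σ , cover , small = null (suc q)
          x , x∈U , x∉σ = escape σ (avoid-cover σ small)
          i , eq = cover x (limsup⊆X x (U-∩⇒limsup x x∈U))
      in x∉σ i (∈-cyl⁺ (σ i) {x} eq)

-- Unions of the cylinders that label a set of levels

module Enumerated (em : ExcludedMiddle 0ℓ) (e : ℕ ↔ Str) where
  open Classical em

  label : ℕ → Str
  label = Inverse.to e

  index : Str → ℕ
  index = Inverse.from e

  -- Excluded middle decides the predicate, so that unions over arbitrary sets of levels are still
  -- decision trees with rational measure.
  piece : (ℕ → Set) → ℕ → Clopen
  piece P N with em {P N}
  ... | yes _ = cyl (label N)
  ... | no  _ = leaf false

  cov : (ℕ → Set) → ℕ → Clopen
  cov P = ⋃ (piece P)

  ∈-cov⁺ : ∀ {P N L x} → N ℕ.< L → P N → restrict x (length (label N)) ≡ label N → x ∈ cov P L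
  ∈-cov⁺ {P} {N} {L} {x} N<L p eq = ∈-⋃⁺ (piece P) N<L x∈piece
    where
    x∈piece : x ∈ piece P N
    x∈piece with em {P N}
    ... | yes _ = ∈-cyl⁺ (label N) eq
    ... | no ¬p = ⊥-elim (¬p p)

  ∈-cov⁻ : ∀ {P x} L → x ∈ cov P L →
           ∃ λ N → N ℕ.< L × P N × restrict x (length (label N)) ≡ label N
  ∈-cov⁻ {P} L h with ∈-⋃⁻ (piece P) L h
  ... | N , N<L , q with em {P N}
  ...   | yes p = N , N<L , p , ∈-cyl⁻ (label N) q

  cov-⊆ : ∀ {P Q L L′} → L ℕ.≤ L′ → (∀ N → N ℕ.< L → P N → Q N) → cov P L ⊆ cov Q L′
  cov-⊆ {L = L} L≤L′ P⇒Q x h with ∈-cov⁻ L h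
  ... | N , N<L , p , eq = ∈-cov⁺ (ℕₚ.<-≤-trans N<L L≤L′) (P⇒Q N N<L p) eq

  cov-⊆-∪ : ∀ {P Q R L} → (∀ N → P N → Q N ⊎ R N) → cov P L ⊆ cov Q L ∪ cov R L
  cov-⊆-∪ {Q = Q} {R} {L} P⇒Q∨R x h with ∈-cov⁻ L h
  ... | N , N<L , p , eq = ∈-∪⁺ {cov Q L} {cov R L}
          ([ (λ q → inj₁ (∈-cov⁺ N<L q eq)) , (λ r → inj₂ (∈-cov⁺ N<L r eq)) ]′ (P⇒Q∨R N p))

  -- A point in infinitely many of the unions has, for every `m`, an initial segment `label N` of
  -- length at least `m` with `N` in the set: the labels used at stage `t` have length at least `t`.
  -- Hence `π` of the set contains a limsup that is not null.
  trN-positive : ∀ q (P : ℕ → ℕ → Set) (L : ℕ → ℕ) →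
                 (∀ t N → P t N → t ℕ.≤ length (label N)) →
                 (∀ t → half^ q ≤ μ (cov (P t) (L t))) →
                 ¬ trN-on-ω e (λ N → ∃ λ t → N ℕ.< L t × P t N)
  trN-positive q P L long big = limsup-not-null q (λ t → cov (P t) (L t)) big _ λ x often m →
    let t , m≤t , x∈W = often m
        N , N<L , p , eq = ∈-cov⁻ (L t) x∈W
        N≡ = trans (cong index eq) (Inverse.strictlyInverseʳ e N)
    in length (label N) , ℕₚ.≤-trans m≤t (long t N p) , t , subst (λ N → N ℕ.< L t × P t N) (sym N≡) (N<L , p)

-- Finite sets of branches

length-restrict : ∀ x n → length (restrict x n) ≡ n
length-restrict x zero    = refl
length-restrict x (suc n) = cong suc (length-restrict (tail x) n)

restrict-⊑ : ∀ x {m n} → m ℕ.≤ n → restrict x m ⊑ restrict x n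
restrict-⊑ x ℕ.z≤n       = []⊑
restrict-⊑ x (ℕ.s≤s m≤n) = ∷⊑ (restrict-⊑ (tail x) m≤n)

⊑-restrict : ∀ {s t} x → s ⊑ t → restrict x (length t) ≡ t →
             length s ℕ.≤ length t × restrict x (length s) ≡ s
⊑-restrict x []⊑      eq = ℕ.z≤n , refl
⊑-restrict x (∷⊑ s⊑t) eq =
  let l , r = ⊑-restrict (tail x) s⊑t (proj₂ (∷-injective eq))
  in ℕ.s≤s l , cong₂ _∷_ (proj₁ (∷-injective eq)) r

∷-⊑-injective : ∀ {b b′ s t} → (b ∷ s) ⊑ (b′ ∷ t) → b ≡ b′ × s ⊑ t
∷-⊑-injective (∷⊑ h) = refl , h

restrict-⊑⇒≡ : ∀ {x y n i} → restrict x n ⊑ restrict y n → i ℕ.< n → x i ≡ y i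
restrict-⊑⇒≡ {n = suc n} {zero}  h _           = proj₁ (∷-⊑-injective h)
restrict-⊑⇒≡ {n = suc n} {suc i} h (ℕ.s≤s i<n) = restrict-⊑⇒≡ (proj₂ (∷-⊑-injective h)) i<n

Agree : ℕ → Real → Real → Set
Agree L x y = ∀ i → i ℕ.< L → x i ≡ y i

agree-refl : ∀ {L x} → Agree L x x
agree-refl i _ = refl

agree-trans : ∀ {L L′ x y z} → L ℕ.≤ L′ → Agree L x y → Agree L′ y z → Agree L x z
agree-trans L≤L′ p q i i<L = trans (p i i<L) (q i (ℕₚ.<-≤-trans i<L L≤L′))

agree-restrict : ∀ {L x y N} → Agree L x y → N ℕ.≤ L → restrict x N ≡ restrict y N
agree-restrict p ℕ.z≤n       = refl
agree-restrict p (ℕ.s≤s N≤L) =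
  cong₂ _∷_ (p 0 (ℕ.s≤s ℕ.z≤n)) (agree-restrict (λ i i<L → p (suc i) (ℕ.s≤s i<L)) N≤L)

flip : ℕ → Real → Real
flip L x i = if i ℕ.≡ᵇ L then not (x i) else x i

flip-agree : ∀ L x → Agree L x (flip L x)
flip-agree L x i i<L with i ℕ.≡ᵇ L in eq
... | false = refl
... | true  = contradiction (ℕₚ.≡ᵇ⇒≡ i L (subst T (sym eq) tt)) (ℕₚ.<⇒≢ i<L)

flip-≢ : ∀ L x → x L ≢ flip L x L
flip-≢ L x with L ℕ.≡ᵇ L in eq
... | true  = not-¬ refl
... | false = ⊥-elim (subst T eq (ℕₚ.≡⇒≡ᵇ L L refl))

-- A tuple of nodes at height `L` is represented by full reals whose bits from `L` on are
-- provisional. An extension keeps the bits below `L`, as well as the order and length of the tuple.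
Extends : ℕ → List Real → List Real → Set
Extends L = Pointwise (Agree L)

extends-refl : ∀ {L V} → Extends L V V
extends-refl {L} = Pointwise.refl λ {x} → agree-refl {L} {x}

extends-trans : ∀ {L L′ V V′ V″} → L ℕ.≤ L′ → Extends L V V′ → Extends L′ V′ V″ → Extends L V V″
extends-trans L≤L′ []       []       = []
extends-trans L≤L′ (p ∷ ps) (q ∷ qs) = agree-trans L≤L′ p q ∷ extends-trans L≤L′ ps qs

extends-weaken : ∀ {L L′ V V′} → L ℕ.≤ L′ → Extends L′ V V′ → Extends L V V′
extends-weaken L≤L′ = extends-trans L≤L′ extends-refl

extends-flip : ∀ {L} V → Extends L V (map (flip L) V)
extends-flip []       = []
extends-flip (x ∷ V) = flip-agree _ x ∷ extends-flip V

extends-++⁻ : ∀ {L} V₁ {V₂ V′} → Extends L (V₁ ++ V₂) V′ →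
              ∃ λ V₁′ → ∃ λ V₂′ → V′ ≡ V₁′ ++ V₂′ × Extends L V₁ V₁′ × Extends L V₂ V₂′
extends-++⁻ []       {V′ = V′} p = [] , V′ , refl , [] , p
extends-++⁻ (x ∷ V₁) (p ∷ ps) with extends-++⁻ V₁ ps
... | V₁′ , V₂′ , refl , q , r = _ ∷ V₁′ , V₂′ , refl , p ∷ q , r

extends-∈ˡ : ∀ {L V V′ x} → Extends L V V′ → x List.∈ V → ∃ λ y → y List.∈ V′ × Agree L x y
extends-∈ˡ (p ∷ ps) (here refl) = _ , here refl , p
extends-∈ˡ (p ∷ ps) (there x∈V) =
  let y , y∈V′ , q = extends-∈ˡ ps x∈V in y , there y∈V′ , q

extends-∈ʳ : ∀ {L V V′ y} → Extends L V V′ → y List.∈ V′ → ∃ λ x → x List.∈ V × Agree L x y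
extends-∈ʳ (p ∷ ps) (here refl) = _ , here refl , p
extends-∈ʳ (p ∷ ps) (there y∈V′) =
  let x , x∈V , q = extends-∈ʳ ps y∈V′ in x , there x∈V , q

double : ℕ → List Real → List Real
double L V = V ++ map (flip L) V

-- What one fusion step must achieve: `above` makes the limit tree perfect, while `below` ensures
-- that later stages add no new nodes up to height `L`.
record Splits (L : ℕ) (V : List Real) (L′ : ℕ) (V′ : List Real) : Set where
  field
    grows : L ℕ.≤ L′
    below : ∀ {y} → y List.∈ V′ → ∃ λ x → x List.∈ V × Agree L x y
    above : ∀ {x} → x List.∈ V → ∃ λ y → ∃ λ z →
              (y List.∈ V′ × Agree L x y) × (z List.∈ V′ × Agree L x z) × ∃ λ i → i ℕ.< L′ × y i ≢ z i

-- The two copies of a branch first differ at bit `L₁`. The second extension starts at height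
-- `suc L₁` and so preserves this bit, and `L₁ < L₂` puts the difference below the new height.
double-splits : ∀ {L V L₁ V₁ L₂ V₂} → L ℕ.≤ L₁ → Extends L V V₁ →
                L₁ ℕ.< L₂ → Extends (suc L₁) (double L₁ V₁) V₂ → Splits L V L₂ V₂
double-splits {L} {V} {L₁} {V₁} {L₂} {V₂} L≤L₁ p L₁<L₂ q = record
  { grows = ℕₚ.≤-trans L≤L₁ (ℕₚ.<⇒≤ L₁<L₂)
  ; below = below
  ; above = above
  }
  where
  L≤1+L₁ = ℕₚ.m≤n⇒m≤1+n L≤L₁
  below : ∀ {y} → y List.∈ V₂ → ∃ λ x → x List.∈ V × Agree L x y
  below y∈ with extends-∈ʳ q y∈
  ... | w , w∈ , w~y with ∈-++⁻ V₁ w∈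
  ...   | inj₁ w∈V₁ =
    let x , x∈ , x~w = extends-∈ʳ p w∈V₁ in x , x∈ , agree-trans L≤1+L₁ x~w w~y
  ...   | inj₂ w∈flip with ∈-map⁻ (flip L₁) w∈flip
  ...     | v , v∈V₁ , refl =
    let x , x∈ , x~v = extends-∈ʳ p v∈V₁
    in x , x∈ , agree-trans L≤1+L₁ (agree-trans L≤L₁ x~v (flip-agree L₁ v)) w~y
  above : ∀ {x} → x List.∈ V → ∃ λ y → ∃ λ z →
            (y List.∈ V₂ × Agree L x y) × (z List.∈ V₂ × Agree L x z) × ∃ λ i → i ℕ.< L₂ × y i ≢ z i
  above x∈ =
    let v , v∈ , x~v = extends-∈ˡ p x∈
        y , y∈ , v~y = extends-∈ˡ q (∈-++⁺ˡ v∈)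
        z , z∈ , v~z = extends-∈ˡ q (∈-++⁺ʳ V₁ (∈-map⁺ (flip L₁) v∈))
    in y , z , (y∈ , agree-trans L≤1+L₁ x~v v~y)
             , (z∈ , agree-trans L≤1+L₁ (agree-trans L≤L₁ x~v (flip-agree L₁ v)) v~z)
             , L₁ , L₁<L₂
             , λ y≡z → flip-≢ L₁ v (trans (v~y L₁ ℕₚ.≤-refl) (trans y≡z (sym (v~z L₁ ℕₚ.≤-refl))))

-- The perfect tree generated by a splitting sequence

module Fusion (L : ℕ → ℕ) (V : ℕ → List Real)
              (splits : ∀ t → Splits (L t) (V t) (L (suc t)) (V (suc t))) where

  tree : Str → Set
  tree s = ∃ λ t → ∃ λ x → x List.∈ V t × length s ℕ.≤ L t × restrict x (length s) ≡ s

  descend : ∀ t d {x} → x List.∈ V (d ℕ.+ t) → ∃ λ y → y List.∈ V t × Agree (L t) y x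
  ascend  : ∀ t d {x} → x List.∈ V t → L t ℕ.≤ L (d ℕ.+ t) × ∃ λ y → y List.∈ V (d ℕ.+ t) × Agree (L t) x y

  ascend t zero    x∈ = ℕₚ.≤-refl , _ , x∈ , agree-refl
  ascend t (suc d) x∈ =
    let l , y , y∈ , x~y = ascend t d x∈
        z , _ , (z∈ , y~z) , _ = Splits.above (splits (d ℕ.+ t)) y∈
    in ℕₚ.≤-trans l (Splits.grows (splits (d ℕ.+ t))) , z , z∈ , agree-trans l x~y y~z

  descend t zero    x∈ = _ , x∈ , agree-refl
  descend t (suc d) x∈ =
    let y , y∈ , y~x = Splits.below (splits (d ℕ.+ t)) x∈
        z , z∈ , z~y = descend t d y∈
        l , _ = ascend t d z∈
    in z , z∈ , agree-trans l z~y y~x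

  -- A node contributed by a later stage is traced back to stage `t`, one from an earlier stage is
  -- followed up to it. Thus the colours of the finitely many branches of `V t` control the whole
  -- tree up to height `L t`.
  tree-level : ∀ t s → tree s → length s ℕ.≤ L t →
               ∃ λ x → x List.∈ V t × restrict x (length s) ≡ s
  tree-level t s (t′ , x , x∈ , l , eq) l′ with ℕₚ.≤-total t t′
  ... | inj₁ t≤t′ =
    let y , y∈ , y~x = descend t (t′ ℕ.∸ t) (subst (λ t → x List.∈ V t) (sym (ℕₚ.m∸n+n≡m t≤t′)) x∈)
    in y , y∈ , trans (agree-restrict y~x l′) eq
  ... | inj₂ t′≤t =
    let _ , y , y∈ , x~y = ascend t′ (t ℕ.∸ t′) x∈
    in y , subst (λ t → y List.∈ V t) (ℕₚ.m∸n+n≡m t′≤t) y∈ , trans (sym (agree-restrict x~y l)) eq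

  tree-perfect : (∃ λ x → x List.∈ V 0) → PerfectTree tree
  tree-perfect (x , x∈) = record
    { root    = 0 , x , x∈ , ℕ.z≤n , refl
    ; initial = λ s t s⊑t (n , x , x∈ , l , eq) →
        let l′ , eq′ = ⊑-restrict x s⊑t eq in n , x , x∈ , ℕₚ.≤-trans l′ l , eq′
    ; perfect = perfect
    }
    where
    leaf-in-tree : ∀ t {y} → y List.∈ V t → tree (restrict y (L t))
    leaf-in-tree t {y} y∈ =
      t , y , y∈ , ℕₚ.≤-reflexive (length-restrict y (L t)) ,
      cong (restrict y) (length-restrict y (L t))
    extends-node : ∀ {s t x y} → length s ℕ.≤ L t → restrict x (length s) ≡ s → Agree (L t) x y →
                   s ⊑ restrict y (L (suc t))
    extends-node {s} {t} {x} {y} l eq x~y =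
      subst (_⊑ restrict y (L (suc t))) (trans (sym (agree-restrict x~y l)) eq)
        (restrict-⊑ y (ℕₚ.≤-trans l (Splits.grows (splits t))))
    perfect : ∀ s → tree s → ∃ λ t → ∃ λ u → s ⊑ t × s ⊑ u × tree t × tree u × Incompatible t u
    perfect s (t , x , x∈ , l , eq) =
      let y , z , (y∈ , x~y) , (z∈ , x~z) , i , i<L , y≢z = Splits.above (splits t) x∈
      in restrict y (L (suc t)) , restrict z (L (suc t)) ,
         extends-node l eq x~y , extends-node l eq x~z ,
         leaf-in-tree (suc t) y∈ , leaf-in-tree (suc t) z∈ ,
         (λ h → y≢z (restrict-⊑⇒≡ h i<L)) , (λ h → y≢z (sym (restrict-⊑⇒≡ h i<L)))

-- Decreasing thresholds and bounds on indices

θ : ℕ → ℚ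
θ m = half^ 1 + half^ (suc m)

½≤θ : ∀ m → half^ 1 ≤ θ m
½≤θ m = subst (_≤ θ m) (ℚₚ.+-identityʳ (half^ 1)) (ℚₚ.+-monoʳ-≤ (half^ 1) (ℚₚ.<⇒≤ (half-pos (suc m))))

-- The gap between consecutive thresholds is cut into two equal parts: one is the measure guaranteed
-- to the true levels, the other the allowance for growth of the exceptional set.
θ-suc : ∀ m → θ m ≡ half^ (3 ℕ.+ m) + (θ (suc m) + half^ (3 ℕ.+ m))
θ-suc m = trans (cong (half^ 1 +_) (trans (sym (half-double (suc m)))
                  (cong (half^ (2 ℕ.+ m) +_) (sym (half-double (2 ℕ.+ m))))))
                (rearrange (half^ 1) (half^ (2 ℕ.+ m)) (half^ (3 ℕ.+ m)))
  where
  rearrange : ∀ o p r → o + (p + (r + r)) ≡ r + ((o + p) + r)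
  rearrange = solve 3 (λ o p r → o :+ (p :+ (r :+ r)) := r :+ ((o :+ p) :+ r)) refl

index-bound : (Str → ℕ) → ℕ → ℕ
index-bound f zero    = f []
index-bound f (suc k) = index-bound (f ∘ (false ∷_)) k ℕ.⊔ index-bound (f ∘ (true ∷_)) k

restrict≤index-bound : ∀ f k x → f (restrict x k) ℕ.≤ index-bound f k
restrict≤index-bound f zero    x = ℕₚ.≤-refl
restrict≤index-bound f (suc k) x with x 0
... | false = ℕₚ.≤-trans (restrict≤index-bound (f ∘ (false ∷_)) k (tail x)) (ℕₚ.m≤m⊔n _ _)
... | true  = ℕₚ.≤-trans (restrict≤index-bound (f ∘ (true ∷_)) k (tail x))
                (ℕₚ.m≤n⊔m (index-bound (f ∘ (false ∷_)) k) _)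

-- Homogeneous trees for a fixed colouring

module Colouring (em : ExcludedMiddle 0ℓ) (e : ℕ ↔ Str) (c : Str → Bool) where
  open Classical em
  open Enumerated em e

  Constant : Bool → List Real → ℕ → Set
  Constant i V N = All (λ x → c (restrict x N) ≡ i) V

  constant-extends : ∀ {i L V V′ N} → Extends L V V′ → N ℕ.≤ L → Constant i V N → Constant i V′ N
  constant-extends p N≤L =
    Pointwise.All-resp-Pointwise (λ x~y eq → trans (cong c (sym (agree-restrict x~y N≤L))) eq) p

  constant-extends⁻ : ∀ {i L V V′ N} → Extends L V V′ → N ℕ.≤ L → Constant i V′ N → Constant i V N
  constant-extends⁻ p N≤L = constant-extends (Pointwise.symmetric (λ x~y i i<L → sym (x~y i i<L)) p) N≤L

  Homogeneous : Set₁
  Homogeneous = Σ (Str → Set) λ p → Σ (ℕ → Set) λ A →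
    PerfectTree p × ¬ trN-on-ω e A × (∃ λ (i : Bool) → ∀ s → p s → A (length s) → c s ≡ i)

  fusion : ∀ i q (L : ℕ → ℕ) (V : ℕ → List Real) (P : ℕ → ℕ → Set) →
           (∃ λ x → x List.∈ V 0) →
           (∀ t → Splits (L t) (V t) (L (suc t)) (V (suc t))) →
           (∀ t N → P t N → t ℕ.≤ length (label N)) →
           (∀ t N → P t N → Constant i (V t) N) →
           (∀ t → half^ q ≤ μ (cov (P t) (L t))) →
           Homogeneous
  fusion i q L V P inhabited splits long constant big =
    tree , (λ N → ∃ λ t → N ℕ.< L t × P t N) , tree-perfect inhabited , trN-positive q P L long big ,
    i , λ s s∈ (t , l , p) →
      let x , x∈ , eq = tree-level t s s∈ (ℕₚ.<⇒≤ l)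
      in trans (cong c (sym eq)) (All.lookup (constant t (length s) p) x∈)
    where open Fusion L V splits

  Falses : ℕ → List Real → ℕ → Set
  Falses k V N = k ℕ.≤ length (label N) × Constant false V N

  Good : ℕ → Set
  Good m = ∀ L V k → length V ≡ m →
           ∃ λ L′ → ∃ λ V′ → L ℕ.≤ L′ × Extends L V V′ × θ m ≤ μ (cov (Falses k V′) L′)

  good-zero : Good 0
  good-zero L [] k refl = L′ , [] , ℕₚ.m≤m⊔n L _ , [] , μ-mono (leaf true) (cov (Falses k []) L′) everything
    where
    -- Beyond the index of every string of length `k`: the empty tuple is vacuously false at all
    -- levels, and these strings alone cover the space, whose measure is `θ 0`.
    L′ = L ℕ.⊔ suc (index-bound index k)
    everything : leaf true ⊆ cov (Falses k []) L′
    everything x _ = ∈-cov⁺ {Falses k []} {index s} {L′} {x}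
      (ℕₚ.≤-trans (ℕ.s≤s (restrict≤index-bound index k x)) (ℕₚ.m≤n⊔m L _))
      (ℕₚ.≤-reflexive (sym len) , [])
      (trans (cong (restrict x) len) (sym label-s))
      where
      s = restrict x k
      label-s : label (index s) ≡ s
      label-s = Inverse.strictlyInverseˡ e s
      len : length (label (index s)) ≡ k
      len = trans (cong length label-s) (length-restrict x k)

  -- All lengths are good: a tree of colour false

  module AllGood (good : ∀ m → Good m) where

    extend : ∀ t L V → ∃ λ L′ → ∃ λ V′ → L ℕ.≤ L′ × Extends L V V′ × half^ 1 ≤ μ (cov (Falses t V′) L′)
    extend t L V =
      let L′ , V′ , l , p , big = good (length V) L V t refl
      in L′ , V′ , l , p , ℚₚ.≤-trans (½≤θ (length V)) big

    stage : ℕ → ℕ × List Real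
    stage-ext : ∀ t → ∃ λ L′ → ∃ λ V′ → proj₁ (stage t) ℕ.≤ L′ × Extends (proj₁ (stage t)) (proj₂ (stage t)) V′
                      × half^ 1 ≤ μ (cov (Falses t V′) L′)
    stage zero    = 0 , (λ _ → false) ∷ []
    stage (suc t) =
      -- Height `suc L` protects the bit `L` at which the copies differ.
      let L , V , _ = stage-ext t in suc L , double L V
    stage-ext t = extend t (proj₁ (stage t)) (proj₂ (stage t))

    homogeneous : Homogeneous
    homogeneous = fusion false 1 (λ t → proj₁ (stage-ext t)) (λ t → proj₁ (proj₂ (stage-ext t)))
      (λ t → Falses t (proj₁ (proj₂ (stage-ext t))))
      (let y , y∈ , _ = extends-∈ˡ (proj₁ (proj₂ (proj₂ (proj₂ (stage-ext 0))))) (here refl) in y , y∈)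
      (λ t → let _ , _ , l , p , _ = stage-ext (suc t) in
        double-splits ℕₚ.≤-refl extends-refl l p)
      (λ t N → proj₁) (λ t N → proj₂)
      (λ t → proj₂ (proj₂ (proj₂ (proj₂ (stage-ext t)))))

  -- A first bad length: a tree of colour true

  record Config : Set where
    constructor config
    field
      height : ℕ
      nodes  : List Real
      side   : List Real

  open Config

  record _≼_ (τ τ′ : Config) : Set where
    constructor ≼-intro
    field
      height-≤     : height τ ℕ.≤ height τ′
      nodes-extend : Extends (height τ) (nodes τ) (nodes τ′)
      side-extend  : Extends (height τ) (side τ) (side τ′)

  open _≼_

  ≼-refl : ∀ {τ} → τ ≼ τ
  ≼-refl = ≼-intro ℕₚ.≤-refl extends-refl extends-refl

  ≼-trans : ∀ {τ₁ τ₂ τ₃} → τ₁ ≼ τ₂ → τ₂ ≼ τ₃ → τ₁ ≼ τ₃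
  ≼-trans (≼-intro l p q) (≼-intro l′ p′ q′) =
    ≼-intro (ℕₚ.≤-trans l l′) (extends-trans l p p′) (extends-trans l q q′)

  module FirstFailure (m : ℕ) (good : Good m) (L₀ : ℕ) (x : Real) (W : List Real) (k₀ : ℕ)
      (|W|≡m : length W ≡ m)
      (fail : ∀ L V → L₀ ℕ.≤ L → Extends L₀ (x ∷ W) V → μ (cov (Falses k₀ V) L) ≤ θ (suc m)) where

    Spoilt : Config → ℕ → Set
    Spoilt τ N = Falses k₀ (side τ) N × ¬ Constant true (nodes τ) N

    spoilt : Config → Clopen
    spoilt τ = cov (Spoilt τ) (height τ)

    -- Colours at levels up to the height depend on fixed bits only, so a prolongation undoes
    -- neither falsity of the side tuple nor a failure of truth among the nodes.
    spoilt-mono : ∀ {τ τ′} → τ ≼ τ′ → spoilt τ ⊆ spoilt τ′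
    spoilt-mono {τ} {τ′} (≼-intro l p q) = cov-⊆ {Spoilt τ} {Spoilt τ′} l λ N N<L ((k , f) , ¬t) →
      (k , constant-extends q (ℕₚ.<⇒≤ N<L) f) , ¬t ∘ constant-extends⁻ p (ℕₚ.<⇒≤ N<L)

    bound : ℚ
    bound = θ (suc m) + half^ (3 ℕ.+ m)

    -- The bound holds for all prolongations, so it survives every choice made later. The reserve
    -- `half^ (t + 3 + m)` pays for future splittings.
    Controlled : ℕ → Config → Set
    Controlled t τ = ∀ τ′ → τ ≼ τ′ → μ (spoilt τ′) + half^ (t ℕ.+ (3 ℕ.+ m)) ≤ bound

    -- With one branch above `x`, not true means false. A spoilt level is then false for a
    -- prolongation of the bad tuple `x ∷ W`, and `fail` applies.
    controlled-zero : Controlled 0 (config L₀ (x ∷ []) W)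
    controlled-zero (config L (y ∷ []) W′) (≼-intro l (p ∷ []) q) = ℚₚ.+-monoˡ-≤ (half^ (3 ℕ.+ m))
      (ℚₚ.≤-trans (μ-mono (spoilt τ′) (cov (Falses k₀ (y ∷ W′)) L)
                     (cov-⊆ {Spoilt τ′} {Falses k₀ (y ∷ W′)} {L} {L} ℕₚ.≤-refl
                       λ N _ ((k , f) , ¬t) → k , ¬-not (λ eq → ¬t (eq ∷ [])) ∷ f))
                  (fail L (y ∷ W′) l (p ∷ q)))
      where τ′ = config L (y ∷ []) W′

    double-config : Config → Config
    double-config (config L V W) = config (suc L) (double L V) W

    -- A prolongation of the doubled configuration consists of two prolongations of `τ` with a
    -- common side tuple. Its spoilt set is covered by theirs, which both contain `spoilt τ` and
    -- exceed it by at most `δ`.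
    double-increment : ∀ {τ τ′ δ} → (∀ τ″ → τ ≼ τ″ → μ (spoilt τ″) ≤ μ (spoilt τ) + δ) →
                       double-config τ ≼ τ′ → μ (spoilt τ′) ≤ μ (spoilt τ) + (δ + δ)
    double-increment {τ@(config L V W)} {config L′ V′ W′} {δ} stable (≼-intro l p q)
      with extends-++⁻ V p
    ... | V₁ , V₂ , refl , p₁ , p₂ =
      ℚₚ.≤-trans (μ-mono (spoilt (config L′ (V₁ ++ V₂) W′)) (spoilt τ₁ ∪ spoilt τ₂)
                   (cov-⊆-∪ {Spoilt (config L′ (V₁ ++ V₂) W′)} {Spoilt τ₁} {Spoilt τ₂} {L′} either))
        (μ-∪-increment {spoilt τ₁} {spoilt τ₂} {spoilt τ} {δ}
          (spoilt-mono τ≼τ₁) (spoilt-mono τ≼τ₂) (stable τ₁ τ≼τ₁) (stable τ₂ τ≼τ₂))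
      where
      τ₁ = config L′ V₁ W′
      τ₂ = config L′ V₂ W′
      τ≼τ₁ : τ ≼ τ₁
      τ≼τ₁ = ≼-intro (ℕₚ.<⇒≤ l) (extends-weaken (ℕₚ.n≤1+n L) p₁) (extends-weaken (ℕₚ.n≤1+n L) q)
      τ≼τ₂ : τ ≼ τ₂
      τ≼τ₂ = ≼-intro (ℕₚ.<⇒≤ l) (extends-trans (ℕₚ.n≤1+n L) (extends-flip V) p₂)
                     (extends-weaken (ℕₚ.n≤1+n L) q)
      either : ∀ N → Spoilt (config L′ (V₁ ++ V₂) W′) N → Spoilt τ₁ N ⊎ Spoilt τ₂ N
      either N (f , ¬t) with em {Constant true V₁ N}
      ... | no  ¬t₁ = inj₁ (f , ¬t₁)
      ... | yes t₁  = inj₂ (f , λ t₂ → ¬t (All.++⁺ t₁ t₂))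

    absorb : ∀ {p r δ h₁ h₀ b} → δ + δ ≡ h₁ → h₁ + h₁ ≡ h₀ → p ≤ r + (δ + δ) → r + h₀ ≤ b → p + h₁ ≤ b
    absorb {p} {r} {δ} {_} {_} {b} refl refl p≤r r≤b = begin
      p + (δ + δ)               ≤⟨ ℚₚ.+-monoˡ-≤ (δ + δ) p≤r ⟩
      r + (δ + δ) + (δ + δ)     ≡⟨ ℚₚ.+-assoc r (δ + δ) (δ + δ) ⟩
      r + ((δ + δ) + (δ + δ))   ≤⟨ r≤b ⟩
      b                         ∎
      where open ≤-Reasoning

    split-controlled : ∀ t τ → Controlled t τ → ∃ λ τ′ → τ ≼ τ′ × Controlled (suc t) (double-config τ′)
    split-controlled t τ controlled =
      -- The tolerance is a quarter of the reserve: the two halves of the split together use up one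
      -- half, and the other half is the reserve for the next stage.
      let τ′ , τ≼τ′ , stable = stabilise _≼_ ≼-refl ≼-trans spoilt (2 ℕ.+ (t ℕ.+ (3 ℕ.+ m))) τ
      in τ′ , τ≼τ′ , λ τ″ τ′≼τ″ →
        absorb {μ (spoilt τ″)} {μ (spoilt τ′)} {half^ (2 ℕ.+ (t ℕ.+ (3 ℕ.+ m)))}
               {half^ (suc (t ℕ.+ (3 ℕ.+ m)))} {half^ (t ℕ.+ (3 ℕ.+ m))} {bound}
          (half-double (suc (t ℕ.+ (3 ℕ.+ m)))) (half-double (t ℕ.+ (3 ℕ.+ m)))
          (double-increment {τ′} {τ″} {half^ (2 ℕ.+ (t ℕ.+ (3 ℕ.+ m)))} stable τ′≼τ″)
          (controlled τ′ τ≼τ′)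

    Trues : ℕ → Config → ℕ → Set
    Trues t τ N = t ℕ.≤ length (label N) × Constant true (nodes τ) N

    leftover : ∀ {h b g p s k} → g ≡ h + b → g ≤ p + s → s + k ≤ b → 0ℚ ≤ k → h ≤ p
    leftover {h} {b} {_} {p} {s} {k} refl g≤ s≤b 0≤k = +-cancelʳ-≤ b (begin
      h + b        ≤⟨ g≤ ⟩
      p + s        ≡⟨ cong (p +_) (ℚₚ.+-identityʳ s) ⟨
      p + (s + 0ℚ) ≤⟨ ℚₚ.+-monoʳ-≤ p (ℚₚ.+-monoʳ-≤ s 0≤k) ⟩
      p + (s + k)  ≤⟨ ℚₚ.+-monoʳ-≤ p s≤b ⟩
      p + b        ∎)
      where open ≤-Reasoning

    -- Levels where the side tuple is false have measure ≥ θ m, of which less than bound is spoilt.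
    prolong-side : ∀ t τ → Controlled t τ → length (side τ) ≡ m →
                   ∃ λ τ′ → τ ≼ τ′ × nodes τ′ ≡ nodes τ × length (side τ′) ≡ m ×
                            half^ (3 ℕ.+ m) ≤ μ (cov (Trues t τ′) (height τ′))
    prolong-side t τ controlled |side| =
      -- The sum `t + k₀` meets both lower bounds on label lengths: `t` for `Trues` and `k₀` for
      -- `Spoilt`.
      let L′ , W′ , l , q , big = good (height τ) (side τ) (t ℕ.+ k₀) |side|
          -- The nodes stay as they are: being full reals, they already have bits up to the new
          -- height.
          τ′ = config L′ (nodes τ) W′
          τ≼τ′ = ≼-intro {τ} {τ′} l extends-refl q
      in τ′ , τ≼τ′ , refl , trans (sym (Pointwise.Pointwise-length q)) |side| ,
         leftover {half^ (3 ℕ.+ m)} {bound} {θ m} {μ (cov (Trues t τ′) L′)} {μ (spoilt τ′)} {half^ (t ℕ.+ (3 ℕ.+ m))}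
           (θ-suc m)
           (ℚₚ.≤-trans big (ℚₚ.≤-trans
             (μ-mono (cov (Falses (t ℕ.+ k₀) W′) L′) (cov (Trues t τ′) L′ ∪ spoilt τ′)
               (cov-⊆-∪ {Falses (t ℕ.+ k₀) W′} {Trues t τ′} {Spoilt τ′} {L′} (either τ′)))
             (μ-∪-≤ (cov (Trues t τ′) L′) (spoilt τ′))))
           (controlled τ′ τ≼τ′)
           (ℚₚ.<⇒≤ (half-pos (t ℕ.+ (3 ℕ.+ m))))
      where
      either : ∀ τ′ N → Falses (t ℕ.+ k₀) (side τ′) N → Trues t τ′ N ⊎ Spoilt τ′ N
      either τ′ N (k , f) with em {Constant true (nodes τ′) N}
      ... | yes p = inj₁ (ℕₚ.m+n≤o⇒m≤o t k , p)
      ... | no ¬p = inj₂ ((ℕₚ.m+n≤o⇒n≤o t k , f) , ¬p)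

    -- Each stage first prolongs the side tuple to gain true levels, then stabilises the spoilt set
    -- in preparation for doubling. The `prolonged` configurations are the ones handed to the
    -- fusion.
    record Stage (t : ℕ) : Set where
      field
        current    : Config
        controlled : Controlled t current
        side-size  : length (side current) ≡ m

      prolonged : Config
      prolonged = proj₁ (prolong-side t current controlled side-size)

      prolonged-≽ : current ≼ prolonged
      prolonged-≽ = proj₁ (proj₂ (prolong-side t current controlled side-size))

      prolonged-nodes : nodes prolonged ≡ nodes current
      prolonged-nodes = proj₁ (proj₂ (proj₂ (prolong-side t current controlled side-size)))

      prolonged-side-size : length (side prolonged) ≡ m
      prolonged-side-size = proj₁ (proj₂ (proj₂ (proj₂ (prolong-side t current controlled side-size))))

      prolonged-large : half^ (3 ℕ.+ m) ≤ μ (cov (Trues t prolonged) (height prolonged))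
      prolonged-large = proj₂ (proj₂ (proj₂ (proj₂ (prolong-side t current controlled side-size))))

      splitting : ∃ λ τ → prolonged ≼ τ × Controlled (suc t) (double-config τ)
      splitting = split-controlled t prolonged λ τ′ h → controlled τ′ (≼-trans prolonged-≽ h)

    open Stage

    next : ∀ {t} → Stage t → Stage (suc t)
    next S = record
      { current    = double-config (proj₁ (splitting S))
      ; controlled = proj₂ (proj₂ (splitting S))
      ; side-size  = trans (sym (Pointwise.Pointwise-length (side-extend (proj₁ (proj₂ (splitting S))))))
                           (prolonged-side-size S)
      }

    stages : ∀ t → Stage t
    stages zero    = record { current = config L₀ (x ∷ []) W ; controlled = controlled-zero ; side-size = |W|≡m }
    stages (suc t) = next (stages t)

    next-splits : ∀ {t} (S : Stage t) →
                  Splits (height (prolonged S)) (nodes (prolonged S))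
                         (height (prolonged (next S))) (nodes (prolonged (next S)))
    next-splits S = double-splits (height-≤ S≼) (nodes-extend S≼)
                      (height-≤ (prolonged-≽ (next S))) (nodes-extend (prolonged-≽ (next S)))
      where S≼ = proj₁ (proj₂ (splitting S))

    homogeneous : Homogeneous
    homogeneous = fusion true (3 ℕ.+ m)
      (λ t → height (prolonged (stages t))) (λ t → nodes (prolonged (stages t)))
      (λ t → Trues t (prolonged (stages t)))
      (x , subst (x List.∈_) (sym (prolonged-nodes (stages 0))) (here refl))
      (λ t → next-splits (stages t))
      (λ t N → proj₁) (λ t N → proj₂)
      (λ t → prolonged-large (stages t))

  -- Failure yields a tuple of length `suc m`, hence of the form `x ∷ W`, with no prolongation
  -- reaching `θ (suc m)`. Its head starts the tree and its tail, of the good length `m`, is the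
  -- first side tuple.
  ¬good-suc⇒homogeneous : ∀ m → Good m → ¬ Good (suc m) → Homogeneous
  ¬good-suc⇒homogeneous m good ¬good with ¬∀⇒∃¬ ¬good
  ... | L₀ , ¬₁ with ¬∀⇒∃¬ ¬₁
  ...   | V , ¬₂ with ¬∀⇒∃¬ ¬₂
  ...     | k₀ , ¬₃ with ¬∀⇒∃¬ ¬₃
  ¬good-suc⇒homogeneous m good ¬good | L₀ , _ | x ∷ W , _ | k₀ , _ | |V|≡ , none =
    FirstFailure.homogeneous m good L₀ x W k₀ (ℕₚ.suc-injective |V|≡)
      λ L V l p → ℚₚ.<⇒≤ (ℚₚ.≰⇒> λ big → none (L , V , l , p , big))

  all-good : ¬ (∃ λ m → Good m × ¬ Good (suc m)) → ∀ m → Good m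
  all-good h zero    = good-zero
  all-good h (suc m) = by-contradiction λ ¬good → h (m , all-good h m , ¬good)

  homogeneous : Homogeneous
  homogeneous with em {∃ λ m → Good m × ¬ Good (suc m)}
  ... | yes (m , good , ¬good) = ¬good-suc⇒homogeneous m good ¬good
  ... | no  none               = AllGood.homogeneous (all-good none)

theorem3p15 : ExcludedMiddle 0ℓ → (e : ℕ ↔ Str) → HL (trN-on-ω e)
theorem3p15 em e c = Colouring.homogeneous em e c
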